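{- Let $B \geq 2$ be an integer. Let $k$ and $n$ be two positive integers such that $1 \leq k < Bn-1$ and suppose that $\frac{k}{Bn-1} = 0.\overline{a_1 \dots a_l}_B$, where $l$ is the length of the period of the base-$B$ representation $0.\overline{a_1 \dots a_l}_B$. For any $i \in \{1, \dots, l\}$ let $\tilde{q}_i, \tilde{r}_i$ be the nonnegative integers such that $$B^i \cdot k = \tilde{q}_i (Bn-1) + \tilde{r}_i, \qquad 0 \leq \tilde{r}_i < Bn-1.$$ Then, for any $i \in \{1, \dots, l\}$: (1) $u_B((\tilde{q}_i)_B) = a_i$; (2) $u_B((\tilde{q}_i)_B) = u_B((\tilde{r}_i)_B)$.
   Context: $\mathbf{N}$ denotes the set of nonnegative integers. For a nonnegative integer $d$, $(d)_B$ denotes $d$ represented in base $B$. The map $u_B : \mathbf{N} \to \{0, \dots, B-1\}$ takes any nonnegative integer, represented in base $B$, to its rightmost figure; that is, $u_B((d)_B)$ is the remainder of the Euclidean division of $d$ by $B$. The notation $0.\overline{a_1 \dots a_l}_B$ denotes the purely periodic base-$B$ expansion with figures $a_1, \dots, a_l \in \{0, \dots, B-1\}$ repeated indefinitely in this order. -}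

module Defs where

open import Data.Fin.Base using (Fin; toℕ)
open import Data.Integer.Base using (+_)
open import Data.Nat.Base as ℕ
  using (ℕ; zero; suc; NonZero; NonTrivial; nonTrivial⇒nonZero; >-nonZero)
open import Data.Nat.DivMod using (_mod_)
open import Data.Nat.Properties using (m^n≢0; m<n⇒0<n)
open import Data.Product.Base using (_×_; ∃-syntax)
open import Data.Rational.Base using (ℚ; 0ℚ; _+_; _-_; _/_; _<_; ∣_∣)
open import Data.Vec.Functional using (Vector)
open import Relation.Binary.PropositionalEquality.Core using (_≡_)

-- The rightmost base-B figure of d is its remainder modulo B.
u : (B : ℕ) .{{_ : NonTrivial B}} → ℕ → Fin B
u B d = _mod_ d B {{nonTrivial⇒nonZero B}}

-- k / N, with N ≢ 0 read off from k < N.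
fraction : (k N : ℕ) → .(k ℕ.< N) → ℚ
fraction k N k<N = _/_ (+ k) N {{>-nonZero (m<n⇒0<n k<N)}}

-- d j is the figure of weight B ^ -(j + 1), i.e. d 0 comes right after the point.
Figures : ℕ → Set
Figures B = ℕ → Fin B

partialSum : (B : ℕ) .{{_ : NonTrivial B}} → Figures B → ℕ → ℚ
partialSum B d zero    = 0ℚ
partialSum B d (suc m) = partialSum B d m + weighted
  where
  weighted : ℚ
  weighted = _/_ (+ toℕ (d m)) (B ℕ.^ suc m)
               {{m^n≢0 B (suc m) {{nonTrivial⇒nonZero B}}}}

-- x = 0.d₀d₁d₂…, as the sum of a convergent series.  Figures that are
-- eventually B - 1 are allowed.
_≡0∙_ : {B : ℕ} .{{_ : NonTrivial B}} → ℚ → Figures B → Set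
_≡0∙_ {B} x d =
  ∀ ε → 0ℚ < ε → ∃[ M ] (∀ m → M ℕ.≤ m → ∣ x - partialSum B d m ∣ < ε)

infix 4 _≡0∙_

-- The figures of the purely periodic expansion whose repeating block is a.
repeating : {B l : ℕ} .{{_ : NonZero l}} → Vector (Fin B) l → Figures B
repeating {l = l} a j = a (j mod l)

IsPeriod : {B : ℕ} → ℕ → Figures B → Set
IsPeriod p d = 0 ℕ.< p × (∀ j → d (p ℕ.+ j) ≡ d j)

IsPeriodLength : {B : ℕ} → ℕ → Figures B → Set
IsPeriodLength l d = IsPeriod l d × (∀ p → IsPeriod p d → l ℕ.≤ p)

{-# OPTIONS --safe #-}

-- Let N = Bn - 1 and let S m be the integer with base-B figures d₀ … dₘ₋₁, so
-- that the m-th partial sum is S m / B ^ m.  The partial sums increase and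
-- (S m + 1) / B ^ m decreases, so passing to the limit gives
-- S m * N ≤ k * B ^ m ≤ (S m + 1) * N.  Equality on the right forces every
-- figure from dₘ on, hence by periodicity every figure, to be B - 1, and then
-- k = N.  So S m is the quotient of B ^ m * k by N, and its last figure is
-- dₘ₋₁.  For (2), q̃ N + r̃ = B ^ i k with N ≡ -1 and B ^ i ≡ 0 modulo B.
module Submission where

open import Defs
open import Data.Fin.Base using (Fin; toℕ)
open import Data.Fin.Properties using (toℕ<n; toℕ-injective; toℕ-fromℕ<; fromℕ<-cong)
open import Data.Integer.Base as ℤ using (+_)
import Data.Integer.Properties as ℤ
open import Data.Nat.Base using (ℕ; zero; suc; _+_; _*_; _∸_; _^_; _≤_; _<_; _⊔_; s≤s⁻¹; _≤′_; ≤′-refl; ≤′-step; NonZero; NonTrivial; nonTrivial⇒nonZero; >-nonZero; >-nonZero⁻¹)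
open import Data.Nat.DivMod using (_%_; m%n<n; m<n⇒m%n≡m; [m+kn]%n≡m%n; _mod_)
open import Data.Nat.Properties
open import Data.Nat.Tactic.RingSolver using (solve-∀)
open import Data.Product.Base using (_×_; _,_; ∃-syntax)
open import Data.Rational.Base as ℚ using (ℚ; 0ℚ; _/_; ∣_∣; toℚᵘ)
import Data.Rational.Properties as ℚ
open import Algebra.Properties.Group ℚ.+-0-group using (⁻¹-anti-homo-//)
import Data.Rational.Unnormalised.Base as ℚᵘ
import Data.Rational.Unnormalised.Properties as ℚᵘ
open import Data.Sum.Base using (inj₁; inj₂)
open import Data.Vec.Functional using (Vector)
open import Relation.Binary.PropositionalEquality

-- Order and sum of fractions by cross-multiplication.

toℚᵘ-/ : ∀ a b .{{_ : NonZero b}} → toℚᵘ (+ a / b) ℚᵘ.≃ + a ℚᵘ./ b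
toℚᵘ-/ a (suc b) = ℚ.toℚᵘ-fromℚᵘ (ℚᵘ.mkℚᵘ (+ a) b)

-- `_/_` reduces to lowest terms, which hides the given numerators and denominators. Up to
-- equivalence they survive in the unnormalised rationals, where the order is the comparison of
-- cross products.
/-mono-≤ : ∀ a b c d .{{_ : NonZero b}} .{{_ : NonZero d}} →
           a * d ≤ c * b → + a / b ℚ.≤ + c / d
/-mono-≤ a b@(suc _) c d@(suc _) ad≤cb = ℚ.toℚᵘ-cancel-≤
  (ℚᵘ.≤-respˡ-≃ (ℚᵘ.≃-sym (toℚᵘ-/ a b)) (ℚᵘ.≤-respʳ-≃ (ℚᵘ.≃-sym (toℚᵘ-/ c d))
    (ℚᵘ.*≤* (subst₂ ℤ._≤_ (ℤ.pos-* a d) (ℤ.pos-* c b) (ℤ.+≤+ ad≤cb)))))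

/-cancel-≤ : ∀ a b c d .{{_ : NonZero b}} .{{_ : NonZero d}} →
             + a / b ℚ.≤ + c / d → a * d ≤ c * b
/-cancel-≤ a b@(suc _) c d@(suc _) p≤q = ℤ.drop‿+≤+
  (subst₂ ℤ._≤_ (sym (ℤ.pos-* a d)) (sym (ℤ.pos-* c b)) (ℚᵘ.drop-*≤*
    (ℚᵘ.≤-respˡ-≃ (toℚᵘ-/ a b) (ℚᵘ.≤-respʳ-≃ (toℚᵘ-/ c d) (ℚ.toℚᵘ-mono-≤ p≤q)))))

/-cross-≡ : ∀ a b c d .{{_ : NonZero b}} .{{_ : NonZero d}} →
            a * d ≡ c * b → + a / b ≡ + c / d
/-cross-≡ a b c d ad≡cb = ℚ.≤-antisym
  (/-mono-≤ a b c d (≤-reflexive ad≡cb)) (/-mono-≤ c d a b (≤-reflexive (sym ad≡cb)))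

/-+-/ : ∀ a b c d .{{_ : NonZero b}} .{{_ : NonZero d}} .{{_ : NonZero (b * d)}} →
        + a / b ℚ.+ + c / d ≡ + (a * d + c * b) / (b * d)
/-+-/ a b@(suc _) c d@(suc _) = ℚ.toℚᵘ-injective (begin
  toℚᵘ (+ a / b ℚ.+ + c / d)             ≈⟨ ℚ.toℚᵘ-homo-+ (+ a / b) (+ c / d) ⟩
  toℚᵘ (+ a / b) ℚᵘ.+ toℚᵘ (+ c / d)     ≈⟨ ℚᵘ.+-cong (toℚᵘ-/ a b) (toℚᵘ-/ c d) ⟩
  (+ a ℚᵘ./ b) ℚᵘ.+ (+ c ℚᵘ./ d)         ≡⟨ ℚᵘ./-cong (sym numerator) refl ⟩
  + (a * d + c * b) ℚᵘ./ (b * d)         ≈⟨ toℚᵘ-/ (a * d + c * b) (b * d) ⟨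
  toℚᵘ (+ (a * d + c * b) / (b * d))     ∎)
  where
  open ℚᵘ.≃-Reasoning
  numerator : + (a * d + c * b) ≡ + a ℤ.* + d ℤ.+ + c ℤ.* + b
  numerator = trans (ℤ.pos-+ (a * d) (c * b)) (cong₂ ℤ._+_ (ℤ.pos-* a d) (ℤ.pos-* c b))

-- Limits of rational sequences and monotone sequences.

_⟶_ : (ℕ → ℚ) → ℚ → Set
f ⟶ x = ∀ ε → 0ℚ ℚ.< ε → ∃[ M ] (∀ m → M ≤ m → ∣ x ℚ.- f m ∣ ℚ.< ε)

p<q⇒0<q-p : ∀ {p q} → p ℚ.< q → 0ℚ ℚ.< q ℚ.- p
p<q⇒0<q-p {p} {q} p<q =
  subst (ℚ._< q ℚ.- p) (ℚ.+-inverseʳ p) (ℚ.+-monoˡ-< (ℚ.- p) p<q)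

p≤∣p∣ : ∀ p → p ℚ.≤ ∣ p ∣
p≤∣p∣ p with ℚ.≤-total 0ℚ p
... | inj₁ 0≤p = ℚ.≤-reflexive (sym (ℚ.0≤p⇒∣p∣≡p 0≤p))
... | inj₂ p≤0 = ℚ.≤-trans p≤0 (ℚ.0≤∣p∣ p)

∣p-q∣≡∣q-p∣ : ∀ p q → ∣ p ℚ.- q ∣ ≡ ∣ q ℚ.- p ∣
∣p-q∣≡∣q-p∣ p q = trans (sym (ℚ.∣-p∣≡∣p∣ (p ℚ.- q))) (cong ∣_∣ (⁻¹-anti-homo-// p q))

-- If `x < c`, take the gap `c - x` as `ε`: the terms from `m₀` on stay at least that far from `x`,
-- so they cannot converge to it.
limit-≥ : ∀ {f x c} m₀ → f ⟶ x → (∀ m → m₀ ≤ m → c ℚ.≤ f m) → c ℚ.≤ x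
limit-≥ {f} {x} {c} m₀ f⟶x c≤f = ℚ.≮⇒≥ λ x<c →
  let M , close = f⟶x (c ℚ.- x) (p<q⇒0<q-p x<c)
      -- An index where both the bound by `c` and the closeness to `x` hold.
      m         = m₀ ⊔ M
      far       = begin
        c ℚ.- x       ≤⟨ ℚ.+-monoˡ-≤ (ℚ.- x) (c≤f m (m≤m⊔n m₀ M)) ⟩
        f m ℚ.- x     ≤⟨ p≤∣p∣ (f m ℚ.- x) ⟩
        ∣ f m ℚ.- x ∣ ≡⟨ ∣p-q∣≡∣q-p∣ (f m) x ⟩
        ∣ x ℚ.- f m ∣ ∎
  in ℚ.<-irrefl refl (ℚ.≤-<-trans far (close m (m≤n⊔m m₀ M)))
  where open ℚ.≤-Reasoning

limit-≤ : ∀ {f x c} m₀ → f ⟶ x → (∀ m → m₀ ≤ m → f m ℚ.≤ c) → x ℚ.≤ c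
limit-≤ {f} {x} {c} m₀ f⟶x f≤c = ℚ.≮⇒≥ λ c<x →
  let M , close = f⟶x (x ℚ.- c) (p<q⇒0<q-p c<x)
      m         = m₀ ⊔ M
      far       = begin
        x ℚ.- c       ≤⟨ ℚ.+-monoʳ-≤ x (ℚ.neg-antimono-≤ (f≤c m (m≤m⊔n m₀ M))) ⟩
        x ℚ.- f m     ≤⟨ p≤∣p∣ (x ℚ.- f m) ⟩
        ∣ x ℚ.- f m ∣ ∎
  in ℚ.<-irrefl refl (ℚ.≤-<-trans far (close m (m≤n⊔m m₀ M)))
  where open ℚ.≤-Reasoning

increasing : ∀ {f : ℕ → ℚ} → (∀ m → f m ℚ.≤ f (suc m)) → ∀ {m n} → m ≤ n → f m ℚ.≤ f n
increasing {f} step m≤n = go (≤⇒≤′ m≤n)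
  where
  go : ∀ {m n} → m ≤′ n → f m ℚ.≤ f n
  go ≤′-refl        = ℚ.≤-refl
  go (≤′-step m≤n′) = ℚ.≤-trans (go m≤n′) (step _)

decreasing : ∀ {f : ℕ → ℚ} → (∀ m → f (suc m) ℚ.≤ f m) → ∀ {m n} → m ≤ n → f n ℚ.≤ f m
decreasing {f} step m≤n = go (≤⇒≤′ m≤n)
  where
  go : ∀ {m n} → m ≤′ n → f n ℚ.≤ f m
  go ≤′-refl        = ℚ.≤-refl
  go (≤′-step m≤n′) = ℚ.≤-trans (step _) (go m≤n′)

-- Periodic figures and Euclidean division.

period-* : ∀ {B p} {d : Figures B} → IsPeriod p d → ∀ t j → d (t * p + j) ≡ d j
period-* per zero j = refl
period-* {p = p} {d} per@(_ , eq) (suc t) j = begin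
  d (p + t * p + j)   ≡⟨ cong d (+-assoc p (t * p) j) ⟩
  d (p + (t * p + j)) ≡⟨ eq (t * p + j) ⟩
  d (t * p + j)       ≡⟨ period-* per t j ⟩
  d j                 ∎
  where open ≡-Reasoning

toℕ-mod : ∀ {l} .{{_ : NonZero l}} (i : Fin l) → toℕ i mod l ≡ i
toℕ-mod {l} i = toℕ-injective
  (trans (toℕ-fromℕ< (m%n<n (toℕ i) l)) (m<n⇒m%n≡m (toℕ<n i)))

-- The intervals from `q * N` to `suc q * N` and from `s * N` to `suc s * N`, right ends excluded,
-- both contain `x`, so each left end is below the other right end; cancelling `N` compares `q` with
-- `s`.
quotient-unique : ∀ N {q r s x} → x ≡ q * N + r → r < N →
                  s * N ≤ x → x < suc s * N → q ≡ s
quotient-unique N {q} {r} {s} refl r<N sN≤x x<sN+N = ≤-antisym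
  (s≤s⁻¹ (*-cancelʳ-< N q (suc s) (≤-<-trans (m≤m+n (q * N) r) x<sN+N)))
  (s≤s⁻¹ (*-cancelʳ-< N s (suc q) (≤-<-trans sN≤x
    (<-≤-trans (+-monoʳ-< (q * N) r<N) (≤-reflexive (+-comm (q * N) N))))))

-- Last figures modulo `B`.

module _ (B : ℕ) .{{_ : NonTrivial B}} where

  private instance
    B≢0 : NonZero B
    B≢0 = nonTrivial⇒nonZero B

  B^_≢0 : ∀ m → NonZero (B ^ m)
  B^ m ≢0 = m^n≢0 B m

  infixl 7 _/B^_

  _/B^_ : ℕ → ℕ → ℚ
  s /B^ m = _/_ (+ s) (B ^ m) {{B^ m ≢0}}

  u-cong : ∀ {x y} → x % B ≡ y % B → u B x ≡ u B y
  u-cong {x} {y} eq = fromℕ<-cong _ _ eq (m%n<n x B) (m%n<n y B)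

  -- `B * c + toℕ e` is `c` with the figure `e` appended, the shape that `truncation` takes at a
  -- successor.
  u-shift : ∀ c (e : Fin B) → u B (B * c + toℕ e) ≡ e
  u-shift c e = begin
    u B (B * c + toℕ e)  ≡⟨ u-cong (cong (_% B) (trans (+-comm (B * c) _) (cong (_+_ (toℕ e)) (*-comm B c)))) ⟩
    u B (toℕ e + c * B)  ≡⟨ u-cong ([m+kn]%n≡m%n (toℕ e) c B) ⟩
    u B (toℕ e)          ≡⟨ toℕ-mod e ⟩
    e                    ∎
    where open ≡-Reasoning

  -- Moving q across turns Bn - 1 into Bn.
  u-quotient≡u-remainder : ∀ n m k q r → 1 ≤ n →
    B ^ suc m * k ≡ q * (B * n ∸ 1) + r → u B q ≡ u B r
  u-quotient≡u-remainder n m k q r 1≤n eq = u-cong (begin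
    q % B                         ≡⟨ [m+kn]%n≡m%n q (B ^ m * k) B ⟨
    (q + B ^ m * k * B) % B       ≡⟨ cong (_% B) moved ⟩
    (r + q * n * B) % B           ≡⟨ [m+kn]%n≡m%n r (q * n) B ⟩
    r % B                         ∎)
    where
    open ≡-Reasoning
    rearrange₁ : ∀ q P k B → q + P * k * B ≡ q + B * P * k
    rearrange₁ = solve-∀
    rearrange₂ : ∀ q N r → q + (q * N + r) ≡ r + q * (1 + N)
    rearrange₂ = solve-∀
    rearrange₃ : ∀ q B n → q * (B * n) ≡ q * n * B
    rearrange₃ = solve-∀
    moved : q + B ^ m * k * B ≡ r + q * n * B
    moved = begin
      q + B ^ m * k * B             ≡⟨ rearrange₁ q (B ^ m) k B ⟩
      q + B ^ suc m * k             ≡⟨ cong (_+_ q) eq ⟩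
      q + (q * (B * n ∸ 1) + r)     ≡⟨ rearrange₂ q (B * n ∸ 1) r ⟩
      -- Since `1 ≤ B * n`, the truncated subtraction is exact.
      r + q * (1 + (B * n ∸ 1))     ≡⟨ cong (λ t → r + q * t) (m+[n∸m]≡n (*-mono-≤ (>-nonZero⁻¹ B) 1≤n)) ⟩
      r + q * (B * n)               ≡⟨ cong (_+_ r) (rearrange₃ q B n) ⟩
      r + q * n * B                 ∎

  -- Truncated expansions and monotone bounds.

  module _ (d : Figures B) where

    truncation : ℕ → ℕ
    truncation zero    = 0
    truncation (suc m) = B * truncation m + toℕ (d m)

    private S = truncation

    -- The right end of the interval of numbers whose expansion can start with the first `m` figures
    -- of `d`.
    upperSum : ℕ → ℚ
    upperSum m = suc (S m) /B^ m

    partialSum≡ : ∀ m → partialSum B d m ≡ S m /B^ m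
    partialSum≡ zero    = refl
    partialSum≡ (suc m) = begin
      partialSum B d m ℚ.+ e /B^ suc m              ≡⟨ cong (ℚ._+ (e /B^ suc m)) (partialSum≡ m) ⟩
      S m /B^ m ℚ.+ e /B^ suc m                     ≡⟨ /-+-/ (S m) P e (B * P) ⟩
      + (S m * (B * P) + e * P) / (P * (B * P))     ≡⟨ /-cross-≡ (S m * (B * P) + e * P) (P * (B * P)) (B * S m + e) (B * P) (rearrange B P (S m) e) ⟩
      (B * S m + e) /B^ suc m                       ∎
      where
      open ≡-Reasoning
      P = B ^ m
      e = toℕ (d m)
      instance
        P≢0 : NonZero P
        P≢0 = B^ m ≢0
        BP≢0 : NonZero (B * P)
        BP≢0 = B^ suc m ≢0
        PBP≢0 : NonZero (P * (B * P))
        PBP≢0 = m*n≢0 P (B * P)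
      rearrange : ∀ B P s e → (s * (B * P) + e * P) * (B * P) ≡ (B * s + e) * (P * (B * P))
      rearrange = solve-∀

    partialSum-step : ∀ m → partialSum B d m ℚ.≤ partialSum B d (suc m)
    partialSum-step m = subst₂ ℚ._≤_ (sym (partialSum≡ m)) (sym (partialSum≡ (suc m)))
      (/-mono-≤ (S m) (B ^ m) (S (suc m)) (B ^ suc m) {{B^ m ≢0}} {{B^ suc m ≢0}} (begin
        S m * (B * B ^ m)             ≡⟨ rearrange B (B ^ m) (S m) ⟩
        B * S m * B ^ m               ≤⟨ *-monoˡ-≤ (B ^ m) (m≤m+n (B * S m) (toℕ (d m))) ⟩
        (B * S m + toℕ (d m)) * B ^ m ∎))
      where
      open ≤-Reasoning
      rearrange : ∀ B P s → s * (B * P) ≡ B * s * P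
      rearrange = solve-∀

    -- A figure is at most `B - 1`. Equality holds exactly when it is `B - 1`, which is how
    -- tightness later determines the figures.
    truncation-suc-≤ : ∀ m → suc (S (suc m)) ≤ B * suc (S m)
    truncation-suc-≤ m = begin
      suc (B * S m + toℕ (d m)) ≡⟨ +-suc (B * S m) (toℕ (d m)) ⟨
      B * S m + suc (toℕ (d m)) ≤⟨ +-monoʳ-≤ (B * S m) (toℕ<n (d m)) ⟩
      B * S m + B               ≡⟨ trans (+-comm (B * S m) B) (sym (*-suc B (S m))) ⟩
      B * suc (S m)             ∎
      where open ≤-Reasoning

    upperSum-step : ∀ m → upperSum (suc m) ℚ.≤ upperSum m
    upperSum-step m = /-mono-≤ (suc (S (suc m))) (B ^ suc m) (suc (S m)) (B ^ m) {{B^ suc m ≢0}} {{B^ m ≢0}} (begin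
      suc (S (suc m)) * B ^ m   ≤⟨ *-monoˡ-≤ (B ^ m) (truncation-suc-≤ m) ⟩
      B * suc (S m) * B ^ m     ≡⟨ rearrange B (B ^ m) (suc (S m)) ⟩
      suc (S m) * (B * B ^ m)   ∎)
      where
      open ≤-Reasoning
      rearrange : ∀ B P s → B * s * P ≡ s * (B * P)
      rearrange = solve-∀

    partialSum≤upperSum : ∀ m → partialSum B d m ℚ.≤ upperSum m
    partialSum≤upperSum m = subst (ℚ._≤ upperSum m) (sym (partialSum≡ m))
      (/-mono-≤ (S m) (B ^ m) (suc (S m)) (B ^ m) {{B^ m ≢0}} {{B^ m ≢0}}
        (*-monoˡ-≤ (B ^ m) (n≤1+n (S m))))

    -- Bounds on the limit and exclusion of equality.

    module _ (k N : ℕ) (k<N : k < N) (k/N≡d : fraction k N k<N ≡0∙ d) where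

      private instance
        N≢0 : NonZero N
        N≢0 = >-nonZero (m<n⇒0<n k<N)

      truncation-lower : ∀ m → S m * N ≤ k * B ^ m
      truncation-lower m = /-cancel-≤ (S m) (B ^ m) k N {{B^ m ≢0}}
        (subst (ℚ._≤ + k / N) (partialSum≡ m)
          -- The expansion hypothesis unfolds to convergence of `partialSum B d` to `+ k / N`.
          (limit-≥ m k/N≡d (λ _ → increasing partialSum-step)))

      truncation-upper : ∀ m → k * B ^ m ≤ suc (S m) * N
      truncation-upper m = /-cancel-≤ k N (suc (S m)) (B ^ m) {{N≢0}} {{B^ m ≢0}}
        -- A later partial sum lies below its own upper sum, hence below the one at `m`.
        (limit-≤ m k/N≡d λ m′ m≤m′ →
          ℚ.≤-trans (partialSum≤upperSum m′) (decreasing upperSum-step m≤m′))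

      -- The case where `k / N` equals `upperSum m`. Convergence alone allows it, through a tail of
      -- figures `B - 1`.
      Tight : ℕ → Set
      Tight m = k * B ^ m ≡ suc (S m) * N

      -- Multiplying tightness by `B` and comparing with the upper bound at `suc m` gives the
      -- reverse of `truncation-suc-≤`.
      tight-suc : ∀ {m} → Tight m → suc (S (suc m)) ≡ B * suc (S m)
      tight-suc {m} tight = ≤-antisym (truncation-suc-≤ m)
        (*-cancelʳ-≤ (B * suc (S m)) (suc (S (suc m))) N (begin
          B * suc (S m) * N     ≡⟨ *-assoc B (suc (S m)) N ⟩
          B * (suc (S m) * N)   ≡⟨ cong (B *_) tight ⟨
          B * (k * B ^ m)       ≡⟨ rearrange B k (B ^ m) ⟩
          k * B ^ suc m         ≤⟨ truncation-upper (suc m) ⟩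
          suc (S (suc m)) * N   ∎))
        where
        open ≤-Reasoning
        rearrange : ∀ B k P → B * (k * P) ≡ k * (B * P)
        rearrange = solve-∀

      tight-step : ∀ {m} → Tight m → Tight (suc m)
      tight-step {m} tight = begin
        k * (B * B ^ m)       ≡⟨ rearrange B k (B ^ m) ⟩
        B * (k * B ^ m)       ≡⟨ cong (B *_) tight ⟩
        B * (suc (S m) * N)   ≡⟨ *-assoc B (suc (S m)) N ⟨
        B * suc (S m) * N     ≡⟨ cong (_* N) (tight-suc tight) ⟨
        suc (S (suc m)) * N   ∎
        where
        open ≡-Reasoning
        rearrange : ∀ B k P → k * (B * P) ≡ B * (k * P)
        rearrange = solve-∀

      tight-≤ : ∀ {m j} → Tight m → m ≤ j → Tight j
      tight-≤ {m} tight m≤j = go (≤⇒≤′ m≤j)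
        where
        go : ∀ {j} → m ≤′ j → Tight j
        go ≤′-refl        = tight
        go (≤′-step m≤j′) = tight-step (go m≤j′)

      tight⇒top : ∀ {m} → Tight m → suc (toℕ (d m)) ≡ B
      tight⇒top {m} tight = +-cancelˡ-≡ (B * S m) (suc (toℕ (d m))) B (begin
        B * S m + suc (toℕ (d m)) ≡⟨ +-suc (B * S m) (toℕ (d m)) ⟩
        suc (S (suc m))           ≡⟨ tight-suc tight ⟩
        B * suc (S m)             ≡⟨ *-suc B (S m) ⟩
        B + B * S m               ≡⟨ +-comm B (B * S m) ⟩
        B * S m + B               ∎)
        where open ≡-Reasoning

      -- The number written with `m` figures `B - 1` is `B ^ m - 1`.
      top⇒truncation : (∀ j → suc (toℕ (d j)) ≡ B) → ∀ m → suc (S m) ≡ B ^ m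
      top⇒truncation top zero    = refl
      top⇒truncation top (suc m) = begin
        suc (B * S m + toℕ (d m)) ≡⟨ +-suc (B * S m) (toℕ (d m)) ⟨
        B * S m + suc (toℕ (d m)) ≡⟨ cong (_+_ (B * S m)) (top m) ⟩
        B * S m + B               ≡⟨ +-comm (B * S m) B ⟩
        B + B * S m               ≡⟨ *-suc B (S m) ⟨
        B * suc (S m)             ≡⟨ cong (B *_) (top⇒truncation top m) ⟩
        B * B ^ m                 ∎
        where open ≡-Reasoning

      periodic⇒¬tight : ∀ {p m} → IsPeriod p d → k * B ^ m ≢ suc (S m) * N
      periodic⇒¬tight {p} {m} per@(0<p , _) tight = <⇒≢ k<N
        (*-cancelʳ-≡ k N (B ^ m) {{B^ m ≢0}} (begin
          k * B ^ m     ≡⟨ tight ⟩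
          suc (S m) * N ≡⟨ cong (_* N) (top⇒truncation top m) ⟩
          B ^ m * N     ≡⟨ *-comm (B ^ m) N ⟩
          N * B ^ m     ∎))
        where
        open ≡-Reasoning
        instance
          p≢0 : NonZero p
          p≢0 = >-nonZero 0<p
        top : ∀ j → suc (toℕ (d j)) ≡ B
        -- Moving `j` forward by `m` periods of positive length `p` reaches an index that is at
        -- least `m`, where tightness still holds.
        top j = trans (cong (λ e → suc (toℕ e)) (sym (period-* per m j)))
          (tight⇒top (tight-≤ tight (≤-trans (m≤m*n m p) (m≤m+n (m * p) j))))

      quotient≡truncation : ∀ {p} → IsPeriod p d → ∀ m {q r} →
        B ^ m * k ≡ q * N + r → r < N → q ≡ S m
      quotient≡truncation per m eq r<N = quotient-unique N
        (trans (*-comm k (B ^ m)) eq) r<N (truncation-lower m)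
        (≤∧≢⇒< (truncation-upper m) (periodic⇒¬tight {m = m} per))

theorem5p3 : (B : ℕ) .{{_ : NonTrivial B}} (k n : ℕ) →
    1 ≤ n → 1 ≤ k → (k<Bn-1 : k < B * n ∸ 1) →
    (l : ℕ) .{{_ : NonZero l}} (a : Vector (Fin B) l) →
    fraction k (B * n ∸ 1) k<Bn-1 ≡0∙ repeating a →
    IsPeriodLength l (repeating a) →
    (q̃ r̃ : Fin l → ℕ) →
    (∀ i → B ^ suc (toℕ i) * k ≡ q̃ i * (B * n ∸ 1) + r̃ i) →
    (∀ i → r̃ i < B * n ∸ 1) →
    ∀ i → (u B (q̃ i) ≡ a i) × (u B (q̃ i) ≡ u B (r̃ i))
theorem5p3 B k n 1≤n _ k<N l a k/N≡a (per , _) q̃ r̃ division r̃<N i =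
  quotient-figure , u-quotient≡u-remainder B n (toℕ i) k (q̃ i) (r̃ i) 1≤n (division i)
  where
  open ≡-Reasoning
  d = repeating a
  quotient-figure : u B (q̃ i) ≡ a i
  quotient-figure = begin
    u B (q̃ i)                        ≡⟨ cong (λ q → u B q) (quotient≡truncation B d k (B * n ∸ 1) k<N k/N≡a per (suc (toℕ i)) (division i) (r̃<N i)) ⟩
    -- `Fin l` counts from 0, so the power `suc (toℕ i)` goes with the figure of index `toℕ i`, the
    -- last one appended.
    u B (truncation B d (suc (toℕ i))) ≡⟨ u-shift B (truncation B d (toℕ i)) (d (toℕ i)) ⟩
    a (toℕ i mod l)                  ≡⟨ cong a (toℕ-mod i) ⟩
    a i                              ∎
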